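{- (i) The unimodal spi-logic $\mathsf{SPi}+\{\iota_{fun}\}$ is complex, and hence complete. On the other hand, the following spi-logics are incomplete: (ii) $\mathsf{SPi}+\{\Diamond p\to p,\ \iota_{fun}\}$; (iii) $\mathsf{SPi}+\{\iota_{refl},\iota_{fun}\}=\mathsf{SPi}+\{\iota_{refl},\iota_{eucl},\iota_{fun}\}$; (iv) $\mathsf{SPi}+\{\iota_{refl},\iota_{trans},\iota_{fun}\}=\mathsf{SPi}+\{\iota_{refl},\iota_{trans},\iota_{sym},\iota_{fun}\}=\mathsf{SPi}+\{\iota_{refl},\iota_{trans},\iota_{eucl},\iota_{fun}\}$; (v) $\mathsf{SPi}+\{\iota_{sym},\iota_{fun}\}$.
   Context: Unimodal setting: one diamond $\Diamond$. Sp-formulas: built from propositional variables and $\top$ by $\wedge$ and $\Diamond$; sp-implications $\sigma\to\tau$. A SLO is an algebra $(A,\wedge,\top,\Diamond)$ with $(A,\wedge,\top)$ a meet-semilattice with top and $\Diamond$ monotone; it validates $\sigma\to\tau$ if $\sigma[\mathfrak a]\le\tau[\mathfrak a]$ for all valuations. Frames $(W,R)$ with standard Kripke semantics. $\mathsf{SPi}+\Sigma$ is the set of sp-implications valid in every SLO validating $\Sigma$; it is complete if it equals the set of sp-implications valid in every frame validating $\Sigma$, incomplete otherwise. For a frame $\mathfrak F=(W,R)$, $\mathfrak F^\star=(2^W,\cap,W,\Diamond^+)$ with $\Diamond^+X=\{w\mid\exists v\in X,(w,v)\in R\}$; a spi-logic $L$ is complex if every SLO validating $L$ embeds (injectively,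 preserving $\wedge,\top,\Diamond$) into $\mathfrak F^\star$ for some frame $\mathfrak F$ validating $L$. Notation: $\iota_{refl}=(p\to\Diamond p)$, $\iota_{trans}=(\Diamond\Diamond p\to\Diamond p)$, $\iota_{sym}=(q\wedge\Diamond p\to\Diamond(p\wedge\Diamond q))$, $\iota_{eucl}=(\Diamond p\wedge\Diamond q\to\Diamond(p\wedge\Diamond q))$, $\iota_{fun}=(\Diamond p\wedge\Diamond q\to\Diamond(p\wedge q))$. -}

module Defs where

open import Algebra.Bundles.Raw using (RawMonoid)
open import Algebra.Lattice.Bundles using (BoundedMeetSemilattice)
open import Algebra.Morphism.Structures using (IsMonoidMonomorphism)
open import Data.List.Base using (List)
open import Data.List.Membership.Propositional using () renaming (_∈_ to _∈ₗ_)
open import Data.Nat.Base using (ℕ)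
open import Data.Product.Base using (∃; _×_; _,_; proj₁; proj₂)
import Data.Unit.Polymorphic.Base as Unit
open import Level using (Level; 0ℓ; _⊔_) renaming (suc to lsuc)
open import Relation.Binary.Construct.NaturalOrder.Left using () renaming (_≤_ to NaturalOrder)
open import Relation.Binary.Core using (Rel)
open import Relation.Nullary.Negation.Core using (¬_)
open import Relation.Unary using (Pred; _∈_; _⊆_; _≐_; _∩_)
open import Relation.Unary.Algebra using (∩-isIdempotentCommutativeMonoid)
open import Relation.Unary.Polymorphic using (U)

private
  variable
    c ℓ s : Level

infixr 7 _∧_
infix  8 ◇_
infix  6 _⇒_

data SpFormula : Set where
  var : ℕ → SpFormula
  ⊤   : SpFormula
  _∧_ : SpFormula → SpFormula → SpFormula
  ◇_  : SpFormula → SpFormula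

data SpImplication : Set where
  _⇒_ : SpFormula → SpFormula → SpImplication

record SLO c ℓ : Set (lsuc (c ⊔ ℓ)) where
  field
    boundedMeetSemilattice : BoundedMeetSemilattice c ℓ

  open BoundedMeetSemilattice boundedMeetSemilattice public
    renaming (_∧_ to _∧ᴬ_; ⊤ to ⊤ᴬ)

  infix 4 _≤_
  _≤_ : Rel Carrier ℓ
  _≤_ = NaturalOrder _≈_ _∧ᴬ_

  field
    ◇ᴬ      : Carrier → Carrier
    ◇ᴬ-mono : ∀ {x y} → x ≤ y → ◇ᴬ x ≤ ◇ᴬ y

  rawMonoid : RawMonoid c ℓ
  rawMonoid = record { Carrier = Carrier ; _≈_ = _≈_ ; _∙_ = _∧ᴬ_ ; ε = ⊤ᴬ }

module _ (A : SLO c ℓ) where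
  open SLO A

  ⟦_⟧ : SpFormula → (ℕ → Carrier) → Carrier
  ⟦ var i ⟧ 𝔞 = 𝔞 i
  ⟦ ⊤     ⟧ 𝔞 = ⊤ᴬ
  ⟦ σ ∧ τ ⟧ 𝔞 = ⟦ σ ⟧ 𝔞 ∧ᴬ ⟦ τ ⟧ 𝔞
  ⟦ ◇ σ   ⟧ 𝔞 = ◇ᴬ (⟦ σ ⟧ 𝔞)

  SLOValidates : Pred SpImplication (c ⊔ ℓ)
  SLOValidates (σ ⇒ τ) = ∀ 𝔞 → ⟦ σ ⟧ 𝔞 ≤ ⟦ τ ⟧ 𝔞

record Frame ℓ : Set (lsuc ℓ) where
  field
    W     : Set ℓ
    R     : Rel W ℓ
    point : W  -- Kripke frames are non-empty

module _ (F : Frame ℓ) where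
  open Frame F

  Forces : (ℕ → Pred W ℓ) → W → SpFormula → Set ℓ
  Forces V w (var i) = w ∈ V i
  Forces V w ⊤       = Unit.⊤
  Forces V w (σ ∧ τ) = Forces V w σ × Forces V w τ
  Forces V w (◇ σ)   = ∃ λ v → R w v × Forces V v σ

  FrameValidates : Pred SpImplication (lsuc ℓ)
  FrameValidates (σ ⇒ τ) = ∀ V w → Forces V w σ → Forces V w τ

  ◇⁺ : Pred W ℓ → Pred W ℓ
  ◇⁺ X w = ∃ λ v → v ∈ X × R w v

-- The power set 2^W is rendered as Pred W ℓ, with extensional equality _≐_.
infix 9 _⋆
_⋆ : Frame ℓ → SLO (lsuc ℓ) ℓ
F ⋆ = record
  { boundedMeetSemilattice = record
      { Carrier                  = Pred W _
      ; _≈_                      = _≐_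
      ; _∧_                      = _∩_
      ; ⊤                        = U
      ; isBoundedMeetSemilattice = ∩-isIdempotentCommutativeMonoid W _
      }
  ; ◇ᴬ      = ◇⁺ F
  ; ◇ᴬ-mono = λ X≤Y →
        (λ (v , v∈X , wRv) →
           (v , v∈X , wRv) , (v , proj₂ (proj₁ X≤Y v∈X) , wRv))
      , proj₁
  }
  where open Frame F

record _↪_ {c₁ ℓ₁ c₂ ℓ₂} (A : SLO c₁ ℓ₁) (B : SLO c₂ ℓ₂) : Set (c₁ ⊔ ℓ₁ ⊔ c₂ ⊔ ℓ₂) where
  private
    module A = SLO A
    module B = SLO B
  field
    to                   : A.Carrier → B.Carrier
    isMonoidMonomorphism : IsMonoidMonomorphism A.rawMonoid B.rawMonoid to
    ◇-homo               : ∀ x → to (A.◇ᴬ x) B.≈ B.◇ᴬ (to x)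

-- Universe levels play the role of size: at level ℓ, "every SLO" ranges over
-- SLO ℓ ℓ and "every frame" over Frame ℓ.

SPi+ : ∀ ℓ → Pred SpImplication s → Pred SpImplication (s ⊔ lsuc ℓ)
SPi+ ℓ Σ ι = (A : SLO ℓ ℓ) → Σ ⊆ SLOValidates A → ι ∈ SLOValidates A

FrameConsequences : ∀ ℓ → Pred SpImplication s → Pred SpImplication (s ⊔ lsuc ℓ)
FrameConsequences ℓ Σ ι = (F : Frame ℓ) → Σ ⊆ FrameValidates F → ι ∈ FrameValidates F

-- Completeness of the spi-logic SPi+ ℓ Σ, in terms of its axioms Σ.
Complete : ∀ ℓ → Pred SpImplication s → Set (s ⊔ lsuc ℓ)
Complete ℓ Σ = SPi+ ℓ Σ ≐ FrameConsequences ℓ Σ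

Incomplete : ∀ ℓ → Pred SpImplication s → Set (s ⊔ lsuc ℓ)
Incomplete ℓ Σ = ¬ Complete ℓ Σ

-- Here L is the spi-logic itself, not a set of axioms for it.
Complex : ∀ ℓ → Pred SpImplication s → Set (s ⊔ lsuc ℓ)
Complex ℓ L = (A : SLO ℓ ℓ) → L ⊆ SLOValidates A →
  ∃ λ (F : Frame ℓ) → L ⊆ FrameValidates F × A ↪ (F ⋆)

fromList : List SpImplication → Pred SpImplication 0ℓ
fromList ιs ι = ι ∈ₗ ιs

p q : SpFormula
p = var 0
q = var 1

ι-refl ι-trans ι-sym ι-eucl ι-fun : SpImplication
ι-refl  = p ⇒ ◇ p
ι-trans = ◇ ◇ p ⇒ ◇ p
ι-sym   = q ∧ ◇ p ⇒ ◇ (p ∧ ◇ q)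
ι-eucl  = ◇ p ∧ ◇ q ⇒ ◇ (p ∧ ◇ q)
ι-fun   = ◇ p ∧ ◇ q ⇒ ◇ (p ∧ q)

{-# OPTIONS --safe #-}

-- Let A be an SLO validating ι-fun, so that ◇ preserves binary meets. For
-- every x and n the set {a | x ∧ ◇ⁿ⊤ ≤ ◇ⁿa} is then a filter. Take the pairs
-- (x , n) as points, with (x , suc n) as the only possible successor of (x , n),
-- present iff x ∧ ◇ⁿ⊤ ≤ ◇ⁿ⁺¹⊤. This frame is functional, and sending a to the
-- set of points whose filter contains a embeds A. (Indexing filters by pairs
-- keeps the frame in the universe of A.)
--
-- For the incompleteness results, reflexive functional frames validate ◇p → p
-- and symmetric functional frames validate ◇◇p → p, yet both fail in any
-- nontrivial SLO in which ◇ is constantly ⊤. Frames for ◇p → p validate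
-- q ∧ ◇p → ◇(p ∧ q), which fails in a power of the two-element semilattice
-- with ◇f = f ∧ f(x₀).

module Submission where

open import Defs
open import Algebra.Bundles using (module CommutativeMonoid)
import Algebra.Construct.Pointwise as Pointwise
open import Algebra.Lattice.Bundles using (BoundedMeetSemilattice)
import Algebra.Lattice.Properties.Semilattice as SemilatticeProperties
open import Algebra.Morphism.Structures using (IsMonoidMonomorphism)
import Algebra.Morphism.MonoidMonomorphism as MonoidMonomorphism
import Algebra.Properties.CommutativeSemigroup as CommutativeSemigroupProperties
open import Algebra.Structures using (IsIdempotentCommutativeMonoid)
open import Data.Bool.Base as Bool using (Bool; true; false; not)
import Data.Bool.Properties as Bool
open import Data.List.Base using (List; []; _∷_; [_])
open import Data.List.Relation.Unary.All as All using (All; []; _∷_)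
open import Data.List.Relation.Unary.Any using (here; there)
open import Data.Nat.Base using (ℕ; zero; suc)
open import Data.Nat.GeneralisedArithmetic using (iterate)
open import Data.Product.Base using (_×_; _,_; proj₁; proj₂)
open import Data.Unit.Polymorphic.Base using (tt)
open import Function.Base using (_∘_; id; const)
open import Level using (Level; 0ℓ; Lift; lift; lower)
open import Relation.Binary.Core using (Rel)
import Relation.Binary.Lattice.Bundles as Order
import Relation.Binary.Lattice.Properties.MeetSemilattice as OrderProperties
open import Relation.Binary.PropositionalEquality using (_≡_; refl; sym; trans; cong₂; subst)
open import Relation.Nullary.Negation.Core using (¬_)
open import Relation.Unary using (Pred; _∈_; _⊆_; _≐_)
open import Relation.Unary.Algebra using (∩-isIdempotentCommutativeMonoid)
open import Relation.Unary.Properties using (≐-refl; ≐-sym; ≐-trans)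

private
  variable
    a c ℓ s : Level
    X : Set a

⟨_,_⟩ : X → X → ℕ → X
⟨ x , y ⟩ zero    = x
⟨ x , y ⟩ (suc _) = y

-- Order and diamonds in an SLO.

module SLOProperties (A : SLO c ℓ) where
  open SLO A hiding (refl; sym; trans)

  meetSemilattice : Order.MeetSemilattice c ℓ ℓ
  meetSemilattice = SemilatticeProperties.∧-orderTheoreticMeetSemilattice semilattice

  open Order.MeetSemilattice meetSemilattice public
    using (antisym; x∧y≤x; x∧y≤y; ∧-greatest)
    renaming (refl to ≤-refl; trans to ≤-trans; reflexive to ≤-reflexive)
  open OrderProperties meetSemilattice public
    using (∧-monotonic)

  ≤⊤ : ∀ x → x ≤ ⊤ᴬ
  ≤⊤ x = SLO.sym A (identityʳ x)

  -- `iterate` adds diamonds innermost: `◇^ (suc n) x` is `◇^ n (◇ᴬ x)` by definition, which the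
  -- edges of the filter frame rely on.
  ◇^ : ℕ → Carrier → Carrier
  ◇^ n x = iterate ◇ᴬ x n

  ◇^-mono : ∀ n {x y} → x ≤ y → ◇^ n x ≤ ◇^ n y
  ◇^-mono zero    x≤y = x≤y
  ◇^-mono (suc n) x≤y = ◇^-mono n (◇ᴬ-mono x≤y)

  PreservesMeets : Set _
  PreservesMeets = ∀ x y → ◇ᴬ x ∧ᴬ ◇ᴬ y ≤ ◇ᴬ (x ∧ᴬ y)

  ι-fun⇒preservesMeets : ι-fun ∈ SLOValidates A → PreservesMeets
  ι-fun⇒preservesMeets fun x y = fun ⟨ x , y ⟩

  ◇^-preservesMeets : PreservesMeets → ∀ n x y → ◇^ n x ∧ᴬ ◇^ n y ≤ ◇^ n (x ∧ᴬ y)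
  ◇^-preservesMeets ◇-∧ zero    x y = ≤-refl
  ◇^-preservesMeets ◇-∧ (suc n) x y =
    ≤-trans (◇^-preservesMeets ◇-∧ n (◇ᴬ x) (◇ᴬ y)) (◇^-mono n (◇-∧ x y))

  module _ (rfl : ι-refl ∈ SLOValidates A) (fun : ι-fun ∈ SLOValidates A) where

    private
      -- Preservation of meets puts both arguments under one diamond; reflexivity then weakens `y`
      -- to `◇ᴬ y`.
      ◇∧◇≤ : ∀ x y → ◇ᴬ x ∧ᴬ ◇ᴬ y ≤ ◇ᴬ (x ∧ᴬ ◇ᴬ y)
      ◇∧◇≤ x y = ≤-trans (ι-fun⇒preservesMeets fun x y)
        (◇ᴬ-mono (∧-monotonic ≤-refl (rfl (const y))))

    refl∧fun⇒eucl : ι-eucl ∈ SLOValidates A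
    refl∧fun⇒eucl 𝔞 = ◇∧◇≤ (𝔞 0) (𝔞 1)

    -- Reflexivity weakens `q` to `◇ q`, which reduces the claim to the Euclidean inequality.
    refl∧fun⇒sym : ι-sym ∈ SLOValidates A
    refl∧fun⇒sym 𝔞 = ≤-trans
      (∧-greatest (x∧y≤y _ _) (≤-trans (x∧y≤x _ _) (rfl (const (𝔞 1)))))
      (◇∧◇≤ (𝔞 0) (𝔞 1))

-- Frame correspondence.

module _ (F : Frame ℓ) where
  open Frame F

  truthSet : (ℕ → Pred W ℓ) → SpFormula → Pred W ℓ
  truthSet V σ w = Forces F V w σ

  Functional : Set ℓ
  Functional = ∀ {w u v} → R w u → R w v → u ≡ v

  functional⇒ι-fun : Functional → ι-fun ∈ FrameValidates F
  functional⇒ι-fun func V w ((u , wRu , u∈p) , (v , wRv , v∈q)) =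
    u , wRu , u∈p , subst (V 1) (func wRv wRu) v∈q

  -- Interpreting `p` and `q` as the singletons of the two successors yields a world equal to both.
  -- The correspondences below use singletons likewise.
  ι-fun⇒functional : ι-fun ∈ FrameValidates F → Functional
  ι-fun⇒functional fun {w} {u} {v} wRu wRv
    with _ , _ , u≡x , v≡x ← fun ⟨ u ≡_ , v ≡_ ⟩ w ((u , wRu , refl) , (v , wRv , refl))
    = trans u≡x (sym v≡x)

  ι-refl⇒reflexive : ι-refl ∈ FrameValidates F → ∀ w → R w w
  ι-refl⇒reflexive rfl w with _ , wRv , refl ← rfl (const (w ≡_)) w refl = wRv

  ι-sym⇒symmetric : ι-sym ∈ FrameValidates F → ∀ {w v} → R w v → R v w
  ι-sym⇒symmetric symm {w} {v} wRv
    with _ , _ , refl , _ , vRw , refl ← symm ⟨ v ≡_ , w ≡_ ⟩ w (refl , v , wRv , refl)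
    = vRw

  ◇p⇒p⇒coreflexive : ◇ p ⇒ p ∈ FrameValidates F → ∀ {w v} → R w v → v ≡ w
  ◇p⇒p⇒coreflexive cor {w} {v} wRv = cor (const (v ≡_)) w (v , wRv , refl)

-- Transfer of validity along embeddings.

module _ {F : Frame ℓ} {A : SLO c s} (e : A ↪ (F ⋆)) where
  open _↪_ e
  open IsMonoidMonomorphism isMonoidMonomorphism

  to-⟦⟧ : ∀ σ 𝔞 → to (⟦_⟧ A σ 𝔞) ≐ truthSet F (to ∘ 𝔞) σ
  to-⟦⟧ (var i) 𝔞 = ≐-refl
  to-⟦⟧ ⊤       𝔞 = ε-homo
  to-⟦⟧ (σ ∧ τ) 𝔞 =
    ≐-trans (homo _ _) (SLO.∧-cong (F ⋆) (to-⟦⟧ σ 𝔞) (to-⟦⟧ τ 𝔞))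
  to-⟦⟧ (◇ σ)   𝔞 = ≐-trans (◇-homo _)
    ( (λ (v , v∈σ , wRv) → v , wRv , proj₁ (to-⟦⟧ σ 𝔞) v∈σ)
    , (λ (v , wRv , v∈σ) → v , proj₂ (to-⟦⟧ σ 𝔞) v∈σ , wRv) )

  -- `x ≤ y` is the equation `x ≈ x ∧ᴬ y`, so injectivity reflects it from an inclusion of truth
  -- sets.
  ↪-validates : FrameValidates F ⊆ SLOValidates A
  ↪-validates {σ ⇒ τ} F⊨ 𝔞 = injective (≐-trans
    ( (λ {w} w∈σ → w∈σ , proj₂ (to-⟦⟧ τ 𝔞) (F⊨ (to ∘ 𝔞) w (proj₁ (to-⟦⟧ σ 𝔞) w∈σ)))
    , proj₁ )
    (≐-sym (homo _ _)))

-- F ⋆ itself lives one universe too high for SPi+ ℓ, but the subalgebra of F ⋆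
-- generated by a single valuation does not.
module Definable (F : Frame ℓ) (V : ℕ → Pred (Frame.W F) ℓ) where
  open Frame F

  private
    open IsIdempotentCommutativeMonoid (∩-isIdempotentCommutativeMonoid W ℓ)
      using (isCommutativeMonoid; idem)

    -- Formulas act as names for the sets they define under `V`.
    _≈_ : Rel (Lift ℓ SpFormula) ℓ
    σ ≈ τ = truthSet F V (lower σ) ≐ truthSet F V (lower τ)

    _⊓_ : Lift ℓ SpFormula → Lift ℓ SpFormula → Lift ℓ SpFormula
    σ ⊓ τ = lift (lower σ ∧ lower τ)

    mono : IsMonoidMonomorphism
      (record { Carrier = Lift ℓ SpFormula ; _≈_ = _≈_ ; _∙_ = _⊓_ ; ε = lift ⊤ })
      (SLO.rawMonoid (F ⋆)) (truthSet F V ∘ lower)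
    mono = record
      { isMonoidHomomorphism = record
        { isMagmaHomomorphism = record
          { isRelHomomorphism = record { cong = id }
          ; homo              = λ _ _ → ≐-refl
          }
        ; ε-homo = ≐-refl
        }
      ; injective = id
      }

  definable : SLO ℓ ℓ
  definable = record
    { boundedMeetSemilattice = record
      { Carrier                  = Lift ℓ SpFormula
      ; _≈_                      = _≈_
      ; _∧_                      = _⊓_
      ; ⊤                        = lift ⊤
      ; isBoundedMeetSemilattice = record
        { isCommutativeMonoid =
            MonoidMonomorphism.isCommutativeMonoid mono isCommutativeMonoid
        ; idem                = λ σ → idem (truthSet F V (lower σ))
        }
      }
    ; ◇ᴬ      = λ σ → lift (◇ lower σ)
    ; ◇ᴬ-mono = λ σ≤τ →
        (λ (v , wRv , v∈σ) → (v , wRv , v∈σ) , (v , wRv , proj₂ (proj₁ σ≤τ v∈σ))) , proj₁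
    }

  definable↪ : definable ↪ (F ⋆)
  definable↪ = record
    { to                   = truthSet F V ∘ lower
    ; isMonoidMonomorphism = mono
    ; ◇-homo               = λ _ →
        (λ (v , wRv , v∈σ) → v , v∈σ , wRv) , (λ (v , v∈σ , wRv) → v , wRv , v∈σ)
    }

-- The definable algebra inherits `Σ` from `F`, hence satisfies the implication.
SPi+-sound : (Σ : Pred SpImplication s) → SPi+ ℓ Σ ⊆ FrameConsequences ℓ Σ
SPi+-sound Σ {σ ⇒ τ} L∋ι F F⊨Σ V w w∈σ =
  proj₁ (to-⟦⟧ definable↪ τ 𝔳) (proj₂ (proj₁ σ≤τ (proj₂ (to-⟦⟧ definable↪ σ 𝔳) w∈σ)))
  where
  open Definable F V
  open SLO definable using (_≤_)

  -- Each variable names its own truth set, so `to-⟦⟧` at `𝔳` recovers forcing under `V`.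
  𝔳 : ℕ → Lift _ SpFormula
  𝔳 = lift ∘ var

  σ≤τ : ⟦_⟧ definable σ 𝔳 ≤ ⟦_⟧ definable τ 𝔳
  σ≤τ = L∋ι definable (λ {ι} ι∈Σ → ↪-validates definable↪ {ι} (F⊨Σ ι∈Σ)) 𝔳

Σ⊆SPi+ : (Σ : Pred SpImplication s) → Σ ⊆ SPi+ ℓ Σ
Σ⊆SPi+ Σ ι∈Σ A A⊨Σ = A⊨Σ ι∈Σ

fromList⊆ : ∀ {ιs} (P : Pred SpImplication s) → All P ιs → fromList ιs ⊆ P
fromList⊆ P all = All.lookup {P = P} all

SPi+-cong : ∀ {ιs κs} →
  ((A : SLO ℓ ℓ) → fromList κs ⊆ SLOValidates A → All (SLOValidates A) ιs) →
  ((A : SLO ℓ ℓ) → fromList ιs ⊆ SLOValidates A → All (SLOValidates A) κs) →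
  SPi+ ℓ (fromList ιs) ≐ SPi+ ℓ (fromList κs)
SPi+-cong κs⊢ιs ιs⊢κs =
    (λ L∋ A A⊨κs → L∋ A (fromList⊆ (SLOValidates A) (κs⊢ιs A A⊨κs)))
  , (λ L∋ A A⊨ιs → L∋ A (fromList⊆ (SLOValidates A) (ιs⊢κs A A⊨ιs)))

-- An SLO validating `Σ` validates the whole logic, so it embeds into `F ⋆` for a frame `F` of that
-- logic. A frame consequence holds in `F` and returns along the embedding.
complex⇒complete : (Σ : Pred SpImplication s) → Complex ℓ (SPi+ ℓ Σ) → Complete ℓ Σ
complex⇒complete {ℓ = ℓ} Σ embed = (λ {ι} → SPi+-sound Σ {ι}) , λ {ι} → complete {ι}
  where
  complete : FrameConsequences ℓ Σ ⊆ SPi+ ℓ Σ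
  complete {ι} ⊨ι A A⊨Σ with F , F⊨L , e ← embed A (λ {κ} κ∈L → κ∈L A A⊨Σ) =
    ↪-validates e {ι} (⊨ι F (λ {κ} κ∈Σ → F⊨L {κ} (Σ⊆SPi+ Σ {κ} κ∈Σ)))

incomplete : {Σ : Pred SpImplication s} (ι : SpImplication) → ι ∈ FrameConsequences ℓ Σ →
  (A : SLO ℓ ℓ) → Σ ⊆ SLOValidates A → ¬ (ι ∈ SLOValidates A) → Incomplete ℓ Σ
incomplete ι ⊨ι A A⊨Σ A⊭ι (_ , FC⊆SPi) = A⊭ι (FC⊆SPi {ι} ⊨ι A A⊨Σ)

-- The filter frame of an SLO.

module FilterFrame (A : SLO ℓ ℓ) (◇-∧ : SLOProperties.PreservesMeets A) where
  open SLO A hiding (refl; sym; trans)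
  open SLOProperties A

  -- `◇ᴬ` need not preserve `⊤ᴬ`; the factor `◇^ n ⊤ᴬ` puts `⊤ᴬ` into every filter.
  generator : Carrier × ℕ → Carrier
  generator (x , n) = x ∧ᴬ ◇^ n ⊤ᴬ

  filter : Carrier × ℕ → Pred Carrier ℓ
  filter w@(_ , n) a = generator w ≤ ◇^ n a

  next : Carrier × ℕ → Carrier × ℕ
  next (x , n) = x , suc n

  frame : Frame ℓ
  frame = record
    { W     = Carrier × ℕ
    -- The filter at `next w` always contains `⊤ᴬ`, so an edge to it must guarantee `◇ᴬ ⊤ᴬ` at `w`.
    ; R     = λ w v → v ≡ next w × filter w (◇ᴬ ⊤ᴬ)
    ; point = ⊤ᴬ , 0
    }

  functional : Functional frame
  functional (u≡ , _) (v≡ , _) = trans u≡ (sym v≡)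

  filter-mono : ∀ w {a b} → a ≤ b → filter w a → filter w b
  filter-mono (_ , n) a≤b w∋a = ≤-trans w∋a (◇^-mono n a≤b)

  generator-next≤ : ∀ w → generator (next w) ≤ generator w
  generator-next≤ (x , n) = ∧-monotonic ≤-refl (◇^-mono n (≤⊤ (◇ᴬ ⊤ᴬ)))

  -- Together with `generator-next≤`, this makes the generators equivalent along an edge. So `a`
  -- lies in the filter of `next w` exactly when `◇ᴬ a` lies in that of `w`: both compare with
  -- `◇^ n (◇ᴬ a)`.
  generator≤next : ∀ w → filter w (◇ᴬ ⊤ᴬ) → generator w ≤ generator (next w)
  generator≤next w w∋◇⊤ = ∧-greatest (x∧y≤x _ _) w∋◇⊤

  embedding : A ↪ (frame ⋆)
  embedding = record
    { to                   = λ a w → filter w a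
    ; isMonoidMonomorphism = record
      { isMonoidHomomorphism = record
        { isMagmaHomomorphism = record
          { isRelHomomorphism = record
            { cong = λ a≈b → (λ {w} → filter-mono w (≤-reflexive a≈b))
                           , (λ {w} → filter-mono w (≤-reflexive (SLO.sym A a≈b)))
            }
          ; homo = λ a b →
              (λ {w} w∋a∧b → filter-mono w (x∧y≤x a b) w∋a∧b , filter-mono w (x∧y≤y a b) w∋a∧b)
            , (λ {w} (w∋a , w∋b) →
                ≤-trans (∧-greatest w∋a w∋b) (◇^-preservesMeets ◇-∧ (proj₂ w) a b))
          }
        ; ε-homo = (λ _ → tt) , (λ _ → x∧y≤y _ _)
        }
      ; injective = λ (a⊆b , b⊆a) → antisym (to-reflects (λ w → a⊆b {w})) (to-reflects (λ w → b⊆a {w}))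
      }
    ; ◇-homo = λ a →
        (λ {w} w∋◇a → next w , ≤-trans (generator-next≤ w) w∋◇a
                             , refl , filter-mono w (◇ᴬ-mono (≤⊤ a)) w∋◇a)
      , (λ { {w} (_ , next∋a , refl , w∋◇⊤) → ≤-trans (generator≤next w w∋◇⊤) next∋a })
    }
    where
    -- The world `(a , 0)` carries the principal filter of `a`.
    to-reflects : ∀ {a b} → (∀ w → filter w a → filter w b) → a ≤ b
    to-reflects {a} a⊆b =
      ≤-trans (∧-greatest ≤-refl (≤⊤ a)) (a⊆b (a , 0) (x∧y≤x a ⊤ᴬ))

SPi+ι-fun-complex : Complex ℓ (SPi+ ℓ (fromList [ ι-fun ]))
SPi+ι-fun-complex A A⊨L =
  -- Validating `ι-fun` suffices: soundness extends it to the whole logic.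
  frame , (λ {ι} L∋ι → SPi+-sound (fromList [ ι-fun ]) {ι} L∋ι frame frame⊨) , embedding
  where
  open FilterFrame A
    (SLOProperties.ι-fun⇒preservesMeets A
      (A⊨L {ι-fun} (Σ⊆SPi+ (fromList [ ι-fun ]) {ι-fun} (here refl))))

  frame⊨ : fromList [ ι-fun ] ⊆ FrameValidates frame
  frame⊨ = fromList⊆ (FrameValidates frame) (functional⇒ι-fun frame functional ∷ [])

-- Algebraic counterexamples.

data ◇-Conclusion : Pred SpImplication 0ℓ where
  ⇒◇ : ∀ {σ τ} → ◇-Conclusion (σ ⇒ ◇ τ)

module BooleanPower (ℓ : Level) where

  open CommutativeSemigroupProperties
    (CommutativeMonoid.commutativeSemigroup Bool.∧-commutativeMonoid) using (interchange)

  -- Lifting the two-point index set makes the counterexamples available at every level.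
  Elt : Set ℓ
  Elt = Lift ℓ Bool → Bool

  power : BoundedMeetSemilattice ℓ ℓ
  power = record
    { Carrier                  = Elt
    ; _≈_                      = λ f g → ∀ x → f x ≡ g x
    ; _∧_                      = λ f g x → f x Bool.∧ g x
    ; ⊤                        = const true
    ; isBoundedMeetSemilattice = record
      { isCommutativeMonoid =
          Pointwise.isCommutativeMonoid (Lift ℓ Bool) Bool.∧-isCommutativeMonoid
      ; idem                = λ f x → Bool.∧-idem (f x)
      }
    }

  ◇≡⊤ : SLO ℓ ℓ
  ◇≡⊤ = record
    { boundedMeetSemilattice = power
    ; ◇ᴬ                     = const (const true)
    ; ◇ᴬ-mono                = λ _ _ → refl
    }

  -- This handles all the axioms except `◇ p ⇒ p`.
  ◇≡⊤-validates : ◇-Conclusion ⊆ SLOValidates ◇≡⊤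
  ◇≡⊤-validates {σ ⇒ _} ⇒◇ 𝔞 = SLOProperties.≤⊤ ◇≡⊤ (⟦_⟧ ◇≡⊤ σ 𝔞)

  ◇≡⊤-refutes : ∀ σ → ¬ (◇ σ ⇒ p ∈ SLOValidates ◇≡⊤)
  ◇≡⊤-refutes σ ◇σ≤p with () ← ◇σ≤p (const (const false)) (lift true)

  -- The interior operator of the Sierpiński space with open point `true`: sets missing that point
  -- become empty.
  interior : Elt → Elt
  interior f x = f x Bool.∧ f (lift true)

  ◇≡interior : SLO ℓ ℓ
  ◇≡interior = record
    { boundedMeetSemilattice = power
    ; ◇ᴬ                     = interior
    ; ◇ᴬ-mono                = λ {f} {g} f≤g x →
        trans (cong₂ Bool._∧_ (f≤g x) (f≤g (lift true))) (interchange (f x) (g x) _ _)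
    }

  ◇≡interior⊨◇p⇒p : ◇ p ⇒ p ∈ SLOValidates ◇≡interior
  ◇≡interior⊨◇p⇒p 𝔞 x =
    SLOProperties.x∧y≤x ◇≡interior (𝔞 0) (λ _ → 𝔞 0 (lift true)) x

  ◇≡interior⊨ι-fun : ι-fun ∈ SLOValidates ◇≡interior
  ◇≡interior⊨ι-fun 𝔞 =
    SLOProperties.≤-reflexive ◇≡interior (λ x → interchange (𝔞 0 x) _ _ _)

  ◇≡interior-refutes : ¬ (q ∧ ◇ p ⇒ ◇ (p ∧ q) ∈ SLOValidates ◇≡interior)
  -- With `p` the whole space and `q` the closed point `false`, `q ∧ ◇ p` contains `false`, but the
  -- interior of `p ∧ q` is empty.
  ◇≡interior-refutes q∧◇p≤ with () ← q∧◇p≤ ⟨ const true , not ∘ lower ⟩ (lift false)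

-- Incompleteness.

◇p⇒p∷fun-incomplete : Incomplete ℓ (fromList (◇ p ⇒ p ∷ ι-fun ∷ []))
◇p⇒p∷fun-incomplete {ℓ} = incomplete (q ∧ ◇ p ⇒ ◇ (p ∧ q)) frames ◇≡interior
  (fromList⊆ (SLOValidates ◇≡interior) (◇≡interior⊨◇p⇒p ∷ ◇≡interior⊨ι-fun ∷ [])) ◇≡interior-refutes
  where
  open BooleanPower ℓ

  frames : q ∧ ◇ p ⇒ ◇ (p ∧ q) ∈ FrameConsequences ℓ (fromList (◇ p ⇒ p ∷ ι-fun ∷ []))
  frames F F⊨ V w (w∈q , v , wRv , v∈p) =
    -- Every edge is a loop, so `q` holds at the successor too.
    v , wRv , v∈p , subst (V 1) (sym (◇p⇒p⇒coreflexive F (F⊨ (here refl)) wRv)) w∈q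

module _ {ιs : List SpImplication} (◇-concl : All ◇-Conclusion ιs) where

  -- Quantifying over the axiom list serves several logics at once. In their frames a world is its
  -- own successor, hence its only one.
  refl∷fun-incomplete : ι-refl ∈ fromList ιs → ι-fun ∈ fromList ιs → Incomplete ℓ (fromList ιs)
  refl∷fun-incomplete {ℓ} refl∈ fun∈ = incomplete (◇ p ⇒ p) frames ◇≡⊤
    (fromList⊆ (SLOValidates ◇≡⊤) (All.map ◇≡⊤-validates ◇-concl)) (◇≡⊤-refutes p)
    where
    open BooleanPower ℓ

    frames : ◇ p ⇒ p ∈ FrameConsequences ℓ (fromList ιs)
    frames F F⊨ V w (v , wRv , v∈p) = subst (V 0)
      (ι-fun⇒functional F (F⊨ fun∈) wRv
        (ι-refl⇒reflexive F (F⊨ refl∈) w))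
      v∈p

  -- Symmetry makes `w` a successor of its successor `v`, so by functionality a second step returns
  -- to `w`.
  sym∷fun-incomplete : ι-sym ∈ fromList ιs → ι-fun ∈ fromList ιs → Incomplete ℓ (fromList ιs)
  sym∷fun-incomplete {ℓ} sym∈ fun∈ = incomplete (◇ ◇ p ⇒ p) frames ◇≡⊤
    (fromList⊆ (SLOValidates ◇≡⊤) (All.map ◇≡⊤-validates ◇-concl)) (◇≡⊤-refutes (◇ p))
    where
    open BooleanPower ℓ

    frames : ◇ ◇ p ⇒ p ∈ FrameConsequences ℓ (fromList ιs)
    frames F F⊨ V w (v , wRv , u , vRu , u∈p) = subst (V 0)
      (ι-fun⇒functional F (F⊨ fun∈) vRu
        (ι-sym⇒symmetric F (F⊨ sym∈) wRv))
      u∈p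

private
  pattern 0th = here refl
  pattern 1st = there 0th
  pattern 2nd = there 1st
  pattern 3rd = there 2nd

theorem5p20 : (ℓ : Level) →
    -- (i)
    ( Complex ℓ (SPi+ ℓ (fromList [ ι-fun ]))
    × Complete ℓ (fromList [ ι-fun ]) )
    -- (ii)
    × Incomplete ℓ (fromList (◇ p ⇒ p ∷ ι-fun ∷ []))
    -- (iii)
    × ( SPi+ ℓ (fromList (ι-refl ∷ ι-fun ∷ [])) ≐ SPi+ ℓ (fromList (ι-refl ∷ ι-eucl ∷ ι-fun ∷ []))
      × Incomplete ℓ (fromList (ι-refl ∷ ι-fun ∷ []))
      × Incomplete ℓ (fromList (ι-refl ∷ ι-eucl ∷ ι-fun ∷ [])) )
    -- (iv)
    × ( SPi+ ℓ (fromList (ι-refl ∷ ι-trans ∷ ι-fun ∷ [])) ≐ SPi+ ℓ (fromList (ι-refl ∷ ι-trans ∷ ι-sym ∷ ι-fun ∷ []))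
      × SPi+ ℓ (fromList (ι-refl ∷ ι-trans ∷ ι-sym ∷ ι-fun ∷ [])) ≐ SPi+ ℓ (fromList (ι-refl ∷ ι-trans ∷ ι-eucl ∷ ι-fun ∷ []))
      × Incomplete ℓ (fromList (ι-refl ∷ ι-trans ∷ ι-fun ∷ []))
      × Incomplete ℓ (fromList (ι-refl ∷ ι-trans ∷ ι-sym ∷ ι-fun ∷ []))
      × Incomplete ℓ (fromList (ι-refl ∷ ι-trans ∷ ι-eucl ∷ ι-fun ∷ [])) )
    -- (v)
    × Incomplete ℓ (fromList (ι-sym ∷ ι-fun ∷ []))
theorem5p20 ℓ =
    (SPi+ι-fun-complex , complex⇒complete (fromList [ ι-fun ]) SPi+ι-fun-complex)
  , ◇p⇒p∷fun-incomplete
  , ( SPi+-cong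
        (λ A A⊨ → A⊨ 0th ∷ A⊨ 2nd ∷ [])
        (λ A A⊨ → A⊨ 0th ∷ eucl A (A⊨ 0th) (A⊨ 1st) ∷ A⊨ 1st ∷ [])
    , refl∷fun-incomplete (⇒◇ ∷ ⇒◇ ∷ []) 0th 1st
    , refl∷fun-incomplete (⇒◇ ∷ ⇒◇ ∷ ⇒◇ ∷ []) 0th 2nd )
  , ( SPi+-cong
        (λ A A⊨ → A⊨ 0th ∷ A⊨ 1st ∷ A⊨ 3rd ∷ [])
        (λ A A⊨ → A⊨ 0th ∷ A⊨ 1st ∷ symm A (A⊨ 0th) (A⊨ 2nd) ∷ A⊨ 2nd ∷ [])
    , SPi+-cong
        -- Reflexivity and functionality yield both `ι-sym` and `ι-eucl`, so each list recovers the
        -- other.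
        (λ A A⊨ → A⊨ 0th ∷ A⊨ 1st ∷ symm A (A⊨ 0th) (A⊨ 3rd) ∷ A⊨ 3rd ∷ [])
        (λ A A⊨ → A⊨ 0th ∷ A⊨ 1st ∷ eucl A (A⊨ 0th) (A⊨ 3rd) ∷ A⊨ 3rd ∷ [])
    , refl∷fun-incomplete (⇒◇ ∷ ⇒◇ ∷ ⇒◇ ∷ []) 0th 2nd
    , refl∷fun-incomplete (⇒◇ ∷ ⇒◇ ∷ ⇒◇ ∷ ⇒◇ ∷ []) 0th 3rd
    , refl∷fun-incomplete (⇒◇ ∷ ⇒◇ ∷ ⇒◇ ∷ ⇒◇ ∷ []) 0th 3rd )
  , sym∷fun-incomplete (⇒◇ ∷ ⇒◇ ∷ []) 0th 1st
  where
  open SLOProperties using () renaming (refl∧fun⇒eucl to eucl; refl∧fun⇒sym to symm)
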